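{- Let $(G,R)$ be a finite rooted graph without sinks such that $t^{ -1}(R)=\emptyset$, the graph $G\setminus\{R\}$ is strongly connected and non-redundant, and $G\setminus\{R\}$ is not circular. If the unfolding tree $\mathcal{T}(G,R)$ is cocompact, then $(G,R)$ admits an actual labelling.
   Context: A graph $G=(VG,EG,o,t)$ is a directed multigraph (loops and multiple edges allowed). A sink is a vertex $v$ with $o^{ -1}(v)=\emptyset$. A path is an empty path $\varepsilon_v$ or a sequence $e_1\cdots e_n$ of edges with $t(e_i)=o(e_{i+1})$; $O(p),T(p)$ are its origin and terminus. A rooted graph $(G,R)$ is a graph with a vertex $R$ from which every vertex is reachable. $G\setminus\{R\}$ is obtained by deleting $R$ and its incident edges; it is strongly connected if every vertex is reachable from every other. $G\setminus\{R\}$ is circular if its vertices can be enumerated $v_0,\dots,v_{N-1}$ so that every edge of $G\setminus\{R\}$ with origin $v_i$ has terminus $v_{i+1 \bmod N}$. A rooted tree is a graph with a vertex $R$ such that every vertex has a unique path from $R$. The unfolding tree $\mathcal{T}(G,R)$ has vertices the paths $p$ with $O(p)=R$ and edges $(p,pe)$ from $p$ to $pe$ for each edge $e$ with $o(e)=T(p)$. For a rooted tree $\mathcal{T}$ with root $R$ and vertex $v$, $\mathcal{T}^v$ is obtained by reversing the edges on the path from $R$ to $v$. $\cong$ is isomorphism of directed graphs. A rooted tree is cocompact if there are a finite set $F$ and $l:V\mathcal{T}\to F$ with $l(v)=l(w)\Rightarrow\mathcal{T}^v\cong\mathcal{T}^w$. Non-edge-collapsing (n.e.c.) relation on a graph $H$: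 an equivalence relation $\sim$ on vertices and on edges, compatible with $o,t$, such that for all vertices $v\sim w$ there are bijections $\pi_{v,w}:o^{ -1}(v)\to o^{ -1}(w)$ with $e\sim f\iff o(e)\sim o(f)$ and $\pi_{o(e),o(f)}(e)=f$. $H$ is non-redundant if its only n.e.c. relation is equality. Multisets over $X$ have positive integer multiplicities; union adds multiplicities; $M\setminus\{x\}$ removes one copy. $t_m(o^{ -1}(v))$ is the multiset of termini of edges leaving $v$ counted with the number of edges; $l(t_m(o^{ -1}(v)))$ its multiset of labels. Actual labelling of $(G,R)$ with $t^{ -1}(R)=\emptyset$: a finite set $X$, maps $l:VG\to X$, $l_p:VG\setminus\{R\}\to X$, and multisets $M_x$ ($x\in X$) such that for all $v\neq R$: (1) $l_p(v)\in M_{l(v)}$; (2) $l(t_m(o^{ -1}(v)))=M_{l(v)}\setminus\{l_p(v)\}$; (3) $l(o(e))=l_p(v)$ for all edges $e$ with $t(e)=v$; and (4) $l(t_m(o^{ -1}(R)))=M_{l(R)}$. -}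

module Defs where

open import Data.Nat using (ℕ; zero; suc; _+_; _∸_; _<_; _%_)
open import Data.Nat.DivMod using (m%n<n)
open import Data.Fin using (Fin; zero; suc; toℕ; fromℕ<; _≟_)
open import Data.Bool using (Bool; true; false; T; _∧_; _∨_; not; if_then_else_)
open import Data.Bool.Properties using (T-∧)
open import Data.List using (List; []; _∷_)
open import Data.List.Properties using (≡-dec)
open import Data.Product using (Σ; ∃; _×_; _,_; proj₁; proj₂)
open import Relation.Nullary using (¬_)
open import Relation.Nullary.Decidable using (⌊_⌋; False)
open import Relation.Binary.PropositionalEquality using (_≡_; refl)
open import Function using (_∘_; _⇔_; Equivalence)
open import Function.Bundles using (_↔_; Inverse)

record Graph : Set₁ where
  field
    V : Set
    E : Set
    o : E → V
    t : E → V

data Path (G : Graph) : Graph.V G → Graph.V G → Set where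
  ε   : ∀ {v} → Path G v v
  _∷_ : ∀ (e : Graph.E G) {w} → Path G (Graph.t G e) w → Path G (Graph.o G e) w

StronglyConnected : Graph → Set
StronglyConnected G = ∀ (v w : Graph.V G) → Path G v w

cycSuc : ∀ {N} → Fin N → Fin N
cycSuc {suc k} i = fromℕ< (m%n<n (suc (toℕ i)) (suc k))

Circular : Graph → Set
Circular G =
  Σ ℕ λ N → Σ (Fin N ↔ Graph.V G) λ enum →
    ∀ (e : Graph.E G) (i : Fin N) →
      Graph.o G e ≡ Inverse.to enum i → Graph.t G e ≡ Inverse.to enum (cycSuc i)

record _≅_ (G H : Graph) : Set where
  field
    isoV  : Graph.V G ↔ Graph.V H
    isoE  : Graph.E G ↔ Graph.E H
    pres-o : ∀ e → Graph.o H (Inverse.to isoE e) ≡ Inverse.to isoV (Graph.o G e)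
    pres-t : ∀ e → Graph.t H (Inverse.to isoE e) ≡ Inverse.to isoV (Graph.t G e)

Out : (H : Graph) → Graph.V H → Set
Out H v = Σ (Graph.E H) λ e → Graph.o H e ≡ v

-- Non-edge-collapsing relations (relations given as Bool-valued, hence
-- proof-irrelevant, predicates)
record NEC (H : Graph) : Set where
  open Graph H
  field
    _~V_ : V → V → Bool
    _~E_ : E → E → Bool
    reflV  : ∀ v → T (v ~V v)
    symV   : ∀ v w → T (v ~V w) → T (w ~V v)
    transV : ∀ u v w → T (u ~V v) → T (v ~V w) → T (u ~V w)
    reflE  : ∀ e → T (e ~E e)
    symE   : ∀ e f → T (e ~E f) → T (f ~E e)
    transE : ∀ e f g → T (e ~E f) → T (f ~E g) → T (e ~E g)
    compat-o : ∀ e f → T (e ~E f) → T (o e ~V o f)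
    compat-t : ∀ e f → T (e ~E f) → T (t e ~V t f)
    π : ∀ v w → T (v ~V w) → Out H v ↔ Out H w
    char : ∀ e f →
      T (e ~E f) ⇔
        (Σ (T (o e ~V o f)) λ h → proj₁ (Inverse.to (π (o e) (o f) h) (e , refl)) ≡ f)

NonRedundant : Graph → Set
NonRedundant H =
  (r : NEC H) →
    (∀ v w → T (NEC._~V_ r v w) → v ≡ w) × (∀ e f → T (NEC._~E_ r e f) → e ≡ f)

reverseAlong : (G : Graph) → (Graph.E G → Bool) → Graph
reverseAlong G P = record
  { V = Graph.V G
  ; E = Graph.E G
  ; o = λ e → if P e then Graph.t G e else Graph.o G e
  ; t = λ e → if P e then Graph.o G e else Graph.t G e
  }

count : ∀ {m} → (Fin m → Bool) → ℕ
count {zero}  f = 0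
count {suc m} f = (if f zero then 1 else 0) + count (f ∘ suc)

module Finite {n m : ℕ} (o t : Fin m → Fin n) (R : Fin n) where

  G : Graph
  G = record { V = Fin n ; E = Fin m ; o = o ; t = t }

  Rooted : Set
  Rooted = ∀ v → Path G R v

  NoSinks : Set
  NoSinks = ∀ (v : Fin n) → Σ (Fin m) λ e → o e ≡ v

  G∖R : Graph
  G∖R = record
    { V = Σ (Fin n) λ v → False (v ≟ R)
    ; E = Σ (Fin m) λ e → False (o e ≟ R) × False (t e ≟ R)
    ; o = λ { (e , p , q) → o e , p }
    ; t = λ { (e , p , q) → t e , q }
    }

  -- Paths starting at R, stored as REVERSED edge lists:
  -- the list eₖ ∷ ⋯ ∷ e₁ ∷ [] represents the path e₁ ⋯ eₖ.
  term : List (Fin m) → Fin n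
  term []      = R
  term (e ∷ p) = t e

  valid : List (Fin m) → Bool
  valid []      = true
  valid (e ∷ p) = ⌊ o e ≟ term p ⌋ ∧ valid p

  TV : Set
  TV = Σ (List (Fin m)) λ p → T (valid p)

  TE : Set
  TE = Σ TV λ p → Σ (Fin m) λ e → T ⌊ o e ≟ term (proj₁ p) ⌋

  extend : TE → TV
  extend ((p , vp) , e , h) = (e ∷ p) , Equivalence.from T-∧ (h , vp)

  Unfold : Graph
  Unfold = record { V = TV ; E = TE ; o = proj₁ ; t = extend }

  -- q is a prefix (initial segment) of the path p, i.e. an ancestor-or-self
  -- of p in the tree (reversed lists: q is a suffix of p)
  isPrefix : List (Fin m) → List (Fin m) → Bool
  isPrefix q []      = ⌊ ≡-dec _≟_ q [] ⌋
  isPrefix q (e ∷ p) = ⌊ ≡-dec _≟_ q (e ∷ p) ⌋ ∨ isPrefix q p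

  onPath : TV → TE → Bool
  onPath v ed = isPrefix (proj₁ (extend ed)) (proj₁ v)

  Unfold^ : TV → Graph
  Unfold^ v = reverseAlong Unfold (onPath v)

  Cocompact : Set
  Cocompact = Σ ℕ λ k → Σ (TV → Fin k) λ l →
    ∀ v w → l v ≡ l w → Unfold^ v ≅ Unfold^ w

  -- Multisets over Fin k: multiplicity functions Fin k → ℕ (0 = absent)
  -- M ∖ {y}
  remove : ∀ {k} → (Fin k → ℕ) → Fin k → (Fin k → ℕ)
  remove M y x = if ⌊ x ≟ y ⌋ then M x ∸ 1 else M x

  outLabels : ∀ {k} → (Fin n → Fin k) → Fin n → (Fin k → ℕ)
  outLabels l v x = count (λ e → ⌊ o e ≟ v ⌋ ∧ ⌊ l (t e) ≟ x ⌋)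

  record ActualLabelling : Set where
    field
      k  : ℕ
      l  : Fin n → Fin k
      lp : (v : Fin n) → False (v ≟ R) → Fin k
      M  : Fin k → (Fin k → ℕ)
      cond1 : ∀ v (v≢R : False (v ≟ R)) → 0 < M (l v) (lp v v≢R)
      cond2 : ∀ v (v≢R : False (v ≟ R)) (x : Fin k) →
                outLabels l v x ≡ remove (M (l v)) (lp v v≢R) x
      cond3 : ∀ (e : Fin m) (te≢R : False (t e ≟ R)) → l (o e) ≡ lp (t e) te≢R
      cond4 : ∀ (x : Fin k) → outLabels l R x ≡ M (l R) x

{-# OPTIONS --safe #-}

-- An isomorphism of rerooted trees is an automorphism of the underlying undirected tree T. By
-- non-redundancy the part of T in front of an edge determines its type, the vertex of G below which
-- the edge leads. By cocompactness every edge can be turned upside down by an automorphism, so the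
-- part of T behind an edge is a cone as well and has a type too. Let W v be the set of types
-- occurring behind edges that lead to v. For an edge v → x every w ∈ W v yields u ∈ W x with
-- N u + δ x = N v + δ w, where N counts out-neighbours; hence W v injects into W x, and by strong
-- connectivity all these injections are bijections. If x and y are two termini of edges leaving v
-- and w ∈ W v, every element of W y has the form N v − δ x − δ y + δ w + δ z for some z; comparing
-- two different w forces z and makes W a singleton. (Without branching, all vertices of G∖R are
-- bisimilar, so there is only one.) With W v = {w v}, vertices are labelled by the multiset
-- N v + δ (w v) of the types of all neighbours, and the parent of v gets the label of w v.
module Submission where

open import Defs
open import Level using (Level)
open import Data.Nat as ℕ using (ℕ; zero; suc; _+_; _*_; _∸_; _≤_; _<_; z≤n; s≤s)
open import Data.Nat.Properties
  using ( ≤-refl; ≤-trans; ≤-reflexive; ≤-antisym; <-irrefl; n≤1+n; n<1+n; m≤n⇒m≤1+n; m≤m+n; m≤n+m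
        ; +-comm; +-assoc; +-identityʳ; +-cancelˡ-≡; +-cancelʳ-≤; +-monoʳ-≤; *-monoˡ-≤; m+n∸n≡m
        ; +-0-commutativeMonoid )
open import Data.Fin using (Fin; zero; suc; toℕ; _≟_)
open import Data.Fin.Properties using (pigeonhole; suc-injective; all?; any?)
open import Data.Bool using (Bool; true; false; T; _∧_; not; if_then_else_)
open import Data.Bool.Properties using (T-∧; T-∨; T-irrelevant; ∧-identityʳ; if-eta)
open import Data.List using (List; []; _∷_; _++_; length; concatMap; allFin)
open import Data.List.Properties using (≡-dec; ∷-injective; length-++)
open import Data.List.Membership.Propositional using (_∈_; lose)
open import Data.List.Membership.Propositional.Properties using (∈-allFin; ∈-concatMap⁺)
open import Data.List.Relation.Unary.All using (All; []; _∷_; lookup)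
open import Data.List.Relation.Unary.Any using (here; there)
open import Data.Product using (Σ; ∃; ∃₂; _×_; _,_; proj₁; proj₂)
open import Data.Sum using (_⊎_; inj₁; inj₂; swap; [_,_]′)
open import Data.Unit using (⊤; tt)
open import Data.Empty using (⊥-elim)
open import Relation.Nullary using (¬_; Dec; yes; no)
open import Relation.Nullary.Decidable
  using ( ⌊_⌋; False; toWitness; fromWitness; toWitnessFalse; fromWitnessFalse; map′; _×-dec_; ¬?
        ; decidable-stable; ¬¬-excluded-middle )
open import Relation.Binary.Definitions using (DecidableEquality)
open import Relation.Binary.Construct.Closure.Equivalence as EqClosure using (EqClosure)
open import Relation.Binary.Construct.Closure.ReflexiveTransitive using (ε; _◅_)
open import Relation.Binary.Construct.Closure.Symmetric using (fwd; bwd)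
open import Relation.Binary.PropositionalEquality
open import Axiom.UniquenessOfIdentityProofs using (module Decidable⇒UIP)
open import Function using (_∘_; case_of_; Equivalence; mk⇔)
open import Function.Bundles using (_↔_; Inverse; mk↔ₛ′)
open import Function.Properties.Inverse using (↔-refl; ↔-sym; ↔-trans)
open import Algebra.Properties.CommutativeMonoid.Sum +-0-commutativeMonoid
  using (sum; ∑-distrib-+; sum-cong-≗; sum-replicate-zero)

private variable
  ℓ ℓ′ : Level
  n m : ℕ

-- Double negation over lists, bijections from relations, class representatives, finite self-maps.

¬¬-All : {A : Set ℓ} {P : A → Set ℓ′} → (∀ x → ¬ ¬ P x) → (xs : List A) → ¬ ¬ All P xs
¬¬-All h []       k = k []
¬¬-All h (x ∷ xs) k = h x λ px → ¬¬-All h xs λ pxs → k (px ∷ pxs)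

↔-fromRelation : {A B : Set} (ρ : A → B → Set) →
  (∀ a → ∃ (ρ a)) → (∀ b → ∃ λ a → ρ a b) →
  (∀ {a b b′} → ρ a b → ρ a b′ → b ≡ b′) →
  (∀ {a a′ b} → ρ a b → ρ a′ b → a ≡ a′) → A ↔ B
↔-fromRelation ρ to from fun inj = mk↔ₛ′ (proj₁ ∘ to) (proj₁ ∘ from)
  (λ b → fun (proj₂ (to _)) (proj₂ (from b)))
  (λ a → inj (proj₂ (from _)) (proj₂ (to a)))

module Representative {A : Set} {_~_ : A → A → Set} (_~?_ : ∀ a b → Dec (a ~ b))
  (~-refl : ∀ {a} → a ~ a) (~-sym : ∀ {a b} → a ~ b → b ~ a)
  (~-trans : ∀ {a b c} → a ~ b → b ~ c → a ~ c) where

  first : A → List A → A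
  first a []       = a
  first a (x ∷ xs) with a ~? x
  ... | yes _ = x
  ... | no  _ = first a xs

  first-~ : ∀ a xs → a ~ first a xs
  first-~ a []       = ~-refl
  first-~ a (x ∷ xs) with a ~? x
  ... | yes a~x = a~x
  ... | no  _   = first-~ a xs

  -- Equivalent elements accept the same entries, so both searches stop at the same place.
  -- Membership of `a` keeps them from falling through to the default, which would differ.
  first-cong : ∀ {a b} xs → a ∈ xs → a ~ b → first a xs ≡ first b xs
  first-cong {a} {b} (x ∷ xs) a∈ a~b with a ~? x | b ~? x
  ... | yes _   | yes _   = refl
  ... | yes a~x | no ¬b~x = ⊥-elim (¬b~x (~-trans (~-sym a~b) a~x))
  ... | no ¬a~x | yes b~x = ⊥-elim (¬a~x (~-trans a~b b~x))
  first-cong (x ∷ xs) (here refl) a~b | no ¬a~x | no _ = ⊥-elim (¬a~x ~-refl)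
  first-cong (x ∷ xs) (there a∈)  a~b | no _    | no _ = first-cong xs a∈ a~b

module _ {Q : Fin n → Set} (F : ∃ Q → ∃ Q)
  (F-inj : ∀ s s′ → proj₁ (F s) ≡ proj₁ (F s′) → proj₁ s ≡ proj₁ s′) where

  private
    iter : ℕ → ∃ Q → ∃ Q
    iter zero    s = s
    iter (suc i) s = F (iter i s)

    cancel : ∀ i j → i < j → ∀ s → proj₁ (iter i s) ≡ proj₁ (iter j s) →
             ∃ λ s′ → proj₁ (F s′) ≡ proj₁ s
    cancel zero    (suc j) _         s eq = iter j s , sym eq
    cancel (suc i) (suc j) (s≤s i<j) s eq = cancel i j i<j s (F-inj _ _ eq)

  -- By pigeonhole two of the first n + 1 iterates of `s` agree, and cancelling `F` leaves `s` as a
  -- value of `F`. Only first components are compared, because proofs of `Q` need not be unique.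
  injective-selfMap⇒surjective : ∀ s → ∃ λ s′ → proj₁ (F s′) ≡ proj₁ s
  injective-selfMap⇒surjective s
    with i , j , i<j , eq ← pigeonhole (n<1+n n) (λ i → proj₁ (iter (toℕ i) s))
    = cancel (toℕ i) (toℕ j) i<j s eq

-- Counting with Boolean predicates on `Fin m`.

𝟙 : Bool → ℕ
𝟙 b = if b then 1 else 0

without : (Fin m → Bool) → Fin m → Fin m → Bool
without f i j = f j ∧ not ⌊ j ≟ i ⌋

T-without : ∀ (f : Fin m → Bool) {i j} → T (f j) → ¬ j ≡ i → T (without f i j)
T-without f {i} {j} fj j≢i with f j | j ≟ i
... | true | yes j≡i = j≢i j≡i
... | true | no _    = tt

without-T : ∀ (f : Fin m → Bool) {i j} → T (without f i j) → T (f j) × ¬ j ≡ i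
without-T f {i} {j} h with f j | j ≟ i
... | true | no j≢i = tt , j≢i

count-cong : {f g : Fin m → Bool} → f ≗ g → count f ≡ count g
count-cong {zero}  f≗g = refl
count-cong {suc m} f≗g = cong₂ (λ b c → 𝟙 b + c) (f≗g zero) (count-cong (f≗g ∘ suc))

count-without : (f : Fin m → Bool) (i : Fin m) → count f ≡ 𝟙 (f i) + count (without f i)
count-without {suc m} f zero with f zero
... | true  = cong suc (count-cong λ j → sym (∧-identityʳ (f (suc j))))
... | false = count-cong λ j → sym (∧-identityʳ (f (suc j)))
count-without {suc m} f (suc i) = begin
  𝟙 (f zero) + count (f ∘ suc)
    ≡⟨ cong (𝟙 (f zero) +_) (count-without (f ∘ suc) i) ⟩
  𝟙 (f zero) + (𝟙 (f (suc i)) + c)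
    ≡⟨ sym (+-assoc (𝟙 (f zero)) _ c) ⟩
  𝟙 (f zero) + 𝟙 (f (suc i)) + c
    ≡⟨ cong (_+ c) (+-comm (𝟙 (f zero)) _) ⟩
  𝟙 (f (suc i)) + 𝟙 (f zero) + c
    ≡⟨ +-assoc (𝟙 (f (suc i))) _ c ⟩
  𝟙 (f (suc i)) + (𝟙 (f zero) + c)
    ≡⟨ cong (𝟙 (f (suc i)) +_) (cong₂ (λ b k → 𝟙 b + k) (sym (∧-identityʳ (f zero)))
         (count-cong λ j → cong (λ b → f (suc j) ∧ not b) (suc-≟ j))) ⟩
  𝟙 (f (suc i)) + count (without f (suc i)) ∎
  where
  open ≡-Reasoning
  c = count (without (f ∘ suc) i)
  suc-≟ : ∀ j → ⌊ j ≟ i ⌋ ≡ ⌊ suc j ≟ suc i ⌋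
  suc-≟ j with j ≟ i
  ... | yes _ = refl
  ... | no _  = refl

T⇒𝟙 : ∀ {b} → T b → 𝟙 b ≡ 1
T⇒𝟙 {true} _ = refl

count-positive : (f : Fin m → Bool) {i : Fin m} → T (f i) → 1 ≤ count f
count-positive f {i} fi rewrite count-without f i | T⇒𝟙 fi = s≤s z≤n

positive-count : (f : Fin m → Bool) → 1 ≤ count f → ∃ (T ∘ f)
positive-count {suc m} f h with f zero in eq
... | true  = zero , subst T (sym eq) tt
... | false with i , fi ← positive-count (f ∘ suc) h = suc i , fi

-- Induction on the source: the partner of the first element is deleted from `g`, and injectivity of
-- `ρ` keeps all later partners away from it.
count-≤ : ∀ {a b} (f : Fin a → Bool) (g : Fin b → Bool) (ρ : Fin a → Fin b → Set) →
  (∀ i → T (f i) → ∃ λ j → T (g j) × ρ i j) →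
  (∀ {i i′ j} → ρ i j → ρ i′ j → i ≡ i′) → count f ≤ count g
count-≤ {zero}  f g ρ tot inj = z≤n
count-≤ {suc a} f g ρ tot inj with f zero in eq
... | false = count-≤ (f ∘ suc) g (ρ ∘ suc) (tot ∘ suc) λ r s → suc-injective (inj r s)
... | true with j , gj , r ← tot zero (subst T (sym eq) tt)
  rewrite count-without g j | T⇒𝟙 gj =
  s≤s (count-≤ (f ∘ suc) (without g j) (ρ ∘ suc)
    (λ i fi → let j′ , gj′ , r′ = tot (suc i) fi in
      j′ , T-without g gj′ (λ { refl → case inj r r′ of λ () }) , r′)
    λ r s → suc-injective (inj r s))

-- Multisets as multiplicity functions: singletons and images.

δ : Fin n → Fin n → ℕ
δ x y = 𝟙 ⌊ x ≟ y ⌋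

δ-refl : (x : Fin n) → δ x x ≡ 1
δ-refl x with x ≟ x
... | yes _  = refl
... | no x≢x = ⊥-elim (x≢x refl)

δ-≢ : {x y : Fin n} → ¬ x ≡ y → δ x y ≡ 0
δ-≢ {x = x} {y} x≢y with x ≟ y
... | yes x≡y = ⊥-elim (x≢y x≡y)
... | no _    = refl

δ-positive : {x y : Fin n} → 1 ≤ δ x y → x ≡ y
δ-positive {x = x} {y} h with x ≟ y
... | yes x≡y = x≡y

δ-injective : {x x′ : Fin n} → δ x ≗ δ x′ → x ≡ x′
δ-injective {x = x} eq = sym (δ-positive (≤-reflexive (trans (sym (δ-refl x)) (eq x))))

-- The image of the multiset `f` under `l`.
push : ∀ {k} → (Fin n → Fin k) → (Fin n → ℕ) → Fin k → ℕ
push l f x = sum λ y → if ⌊ l y ≟ x ⌋ then f y else 0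

push-cong : ∀ {k} (l : Fin n → Fin k) {f g : Fin n → ℕ} → f ≗ g → push l f ≗ push l g
push-cong l f≗g x = sum-cong-≗ λ y → cong (λ c → if ⌊ l y ≟ x ⌋ then c else 0) (f≗g y)

push-+ : ∀ {k} (l : Fin n → Fin k) (f g : Fin n → ℕ) x →
  push l (λ y → f y + g y) x ≡ push l f x + push l g x
push-+ l f g x = trans
  (sum-cong-≗ λ y → if-+ ⌊ l y ≟ x ⌋)
  (∑-distrib-+ (λ y → if ⌊ l y ≟ x ⌋ then f y else 0) (λ y → if ⌊ l y ≟ x ⌋ then g y else 0))
  where
  if-+ : ∀ b {c d} → (if b then c + d else 0) ≡ (if b then c else 0) + (if b then d else 0)
  if-+ true  = refl
  if-+ false = refl

push-0 : ∀ {k} (l : Fin n → Fin k) x → push l (λ _ → 0) x ≡ 0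
push-0 {n} l x = trans (sum-cong-≗ λ y → if-eta ⌊ l y ≟ x ⌋) (sum-replicate-zero n)

push-δ : ∀ {k} (l : Fin n → Fin k) w → push l (δ w) ≗ δ (l w)
push-δ {suc n} l zero x = trans
  (cong (δ (l zero) x +_) (push-0 (l ∘ suc) x))
  (+-comm (δ (l zero) x) 0)
push-δ {suc n} l (suc w) x = begin
  (if ⌊ l zero ≟ x ⌋ then 0 else 0) + push (l ∘ suc) (λ y → δ (suc w) (suc y)) x
    ≡⟨ cong₂ _+_ (if-eta ⌊ l zero ≟ x ⌋) (push-cong (l ∘ suc) δ-suc x) ⟩
  push (l ∘ suc) (δ w) x
    ≡⟨ push-δ (l ∘ suc) w x ⟩
  δ (l (suc w)) x ∎
  where
  open ≡-Reasoning
  δ-suc : ∀ y → δ (suc w) (suc y) ≡ δ w y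
  δ-suc y with w ≟ y
  ... | yes _ = refl
  ... | no _  = refl

-- Induction on the edges: each contributes a singleton or nothing, and `push` is additive.
push-count : ∀ {k} (l : Fin n → Fin k) (P : Fin m → Bool) (t : Fin m → Fin n) x →
  push l (λ y → count λ e → P e ∧ ⌊ t e ≟ y ⌋) x ≡ count λ e → P e ∧ ⌊ l (t e) ≟ x ⌋
push-count {m = zero}  l P t x = push-0 l x
push-count {m = suc m} l P t x = trans
  (push-+ l (λ y → 𝟙 (P zero ∧ ⌊ t zero ≟ y ⌋)) _ x)
  (cong₂ _+_ (head (P zero)) (push-count l (P ∘ suc) (t ∘ suc) x))
  where
  head : ∀ b → push l (λ y → 𝟙 (b ∧ ⌊ t zero ≟ y ⌋)) x ≡ 𝟙 (b ∧ ⌊ l (t zero) ≟ x ⌋)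
  head true  = push-δ l (t zero) x
  head false = push-0 l x

-- Non-redundant graphs have no non-trivial bisimulations

module Bisimulation (H : Graph)
  (_≟V_ : DecidableEquality (Graph.V H)) (_≟E_ : DecidableEquality (Graph.E H)) where

  open Graph H
  open Inverse using (to; from; strictlyInverseˡ; strictlyInverseʳ)

  -- Weaker than an `NEC`: `S` need not be an equivalence, and the bijections need not be coherent
  -- with each other.
  IsBisimulation : (V → V → Set) → Set
  IsBisimulation S = ∀ {v w} → S v w →
    Σ (Out H v ↔ Out H w) λ σ → ∀ e → S (t (proj₁ e)) (t (proj₁ (to σ e)))

  closure-isBisimulation : ∀ {S} → IsBisimulation S → IsBisimulation (EqClosure S)
  closure-isBisimulation bis ε = ↔-refl , λ _ → ε
  closure-isBisimulation bis (fwd s ◅ r)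
    with σ , hσ ← bis s | τ , hτ ← closure-isBisimulation bis r
    = ↔-trans σ τ , λ e → fwd (hσ e) ◅ hτ (to σ e)
  closure-isBisimulation {S} bis (bwd s ◅ r)
    with σ , hσ ← bis s | τ , hτ ← closure-isBisimulation bis r
    = ↔-trans (↔-sym σ) τ , λ e →
        bwd (subst (λ f → S (t (proj₁ (from σ e))) (t (proj₁ f))) (strictlyInverseˡ σ e) (hσ (from σ e)))
        ◅ hτ (from σ e)

  Out-≡ : ∀ {v} {e f : Out H v} → proj₁ e ≡ proj₁ f → e ≡ f
  Out-≡ {e = _ , p} {_ , q} refl = cong (_ ,_) (Decidable⇒UIP.≡-irrelevant _≟V_ p q)

  -- Edges are compared after transport to the out-edges of class representatives, which makes
  -- the bijections π coherent.
  module Quotient (rep : V → V) (σ : ∀ v → Out H v ↔ Out H (rep v))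
    (rep-t : ∀ v (e : Out H v) → rep (t (proj₁ e)) ≡ rep (t (proj₁ (to (σ v) e)))) where

    image : E → E
    image e = proj₁ (to (σ (o e)) (e , refl))

    image-out : ∀ {v} (e : Out H v) → image (proj₁ e) ≡ proj₁ (to (σ v) e)
    image-out (e , refl) = refl

    o-image : ∀ e → o (image e) ≡ rep (o e)
    o-image e = proj₂ (to (σ (o e)) (e , refl))

    transport : ∀ {u v} → u ≡ v → Out H u ↔ Out H v
    transport refl = ↔-refl

    transport-edge : ∀ {u v} (p : u ≡ v) e → proj₁ (to (transport p) e) ≡ proj₁ e
    transport-edge refl e = refl

    π′ : ∀ {v w} → rep v ≡ rep w → Out H v ↔ Out H w
    π′ {v} {w} p = ↔-trans (σ v) (↔-trans (transport p) (↔-sym (σ w)))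

    image-π′ : ∀ {v w} (p : rep v ≡ rep w) e → image (proj₁ (to (π′ p) e)) ≡ image (proj₁ e)
    image-π′ {v} {w} p e = begin
      image (proj₁ (to (π′ p) e))
        ≡⟨ image-out (to (π′ p) e) ⟩
      proj₁ (to (σ w) (to (π′ p) e))
        ≡⟨ cong proj₁ (strictlyInverseˡ (σ w) _) ⟩
      proj₁ (to (transport p) (to (σ v) e))
        ≡⟨ transport-edge p _ ⟩
      proj₁ (to (σ v) e)
        ≡⟨ sym (image-out e) ⟩
      image (proj₁ e) ∎
      where open ≡-Reasoning

    image-injective : ∀ {v} (e f : Out H v) → image (proj₁ e) ≡ image (proj₁ f) → e ≡ f
    image-injective {v} e f eq = trans (sym (strictlyInverseʳ (σ v) e)) (trans
      (cong (from (σ v)) (Out-≡ (trans (sym (image-out e)) (trans eq (image-out f)))))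
      (strictlyInverseʳ (σ v) f))

    image⇒rep : ∀ {e f} → image e ≡ image f → rep (o e) ≡ rep (o f)
    image⇒rep {e} {f} eq = trans (sym (o-image e)) (trans (cong o eq) (o-image f))

    nec : NEC H
    nec = record
      { _~V_     = λ v w → ⌊ rep v ≟V rep w ⌋
      ; _~E_     = λ e f → ⌊ image e ≟E image f ⌋
      ; reflV    = λ _ → fromWitness refl
      ; symV     = λ _ _ p → fromWitness (sym (toWitness p))
      ; transV   = λ _ _ _ p q → fromWitness (trans (toWitness p) (toWitness q))
      ; reflE    = λ _ → fromWitness refl
      ; symE     = λ _ _ p → fromWitness (sym (toWitness p))
      ; transE   = λ _ _ _ p q → fromWitness (trans (toWitness p) (toWitness q))
      ; compat-o = λ _ _ p → fromWitness (image⇒rep (toWitness p))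
      ; compat-t = λ e f p → fromWitness (trans (rep-t (o e) (e , refl))
                     (trans (cong (rep ∘ t) (toWitness p)) (sym (rep-t (o f) (f , refl)))))
      ; π        = λ _ _ p → π′ (toWitness p)
      -- `π′` preserves `image`, and `image` is injective on the out-edges of one vertex, so equal
      -- images single out the edge that `π′` selects.
      ; char     = λ e f → mk⇔
          (λ p → let q = fromWitness (image⇒rep (toWitness p)) in
             q , cong proj₁ (image-injective (to (π′ (toWitness q)) (e , refl)) (f , refl)
                   (trans (image-π′ (toWitness q) (e , refl)) (toWitness p))))
          (λ (q , p) → fromWitness (trans (sym (image-π′ (toWitness q) (e , refl))) (cong image p)))
      }

  module Collapse {S} (bis : IsBisimulation S) (xs : List V) (complete : ∀ v → v ∈ xs)
    (_~?_ : ∀ a b → Dec (EqClosure S a b)) where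

    open Representative _~?_ ε (EqClosure.symmetric S) (EqClosure.transitive S)

    rep : V → V
    rep v = first v xs

    rep-out : ∀ v → Σ (Out H v ↔ Out H (rep v)) λ σ →
      ∀ e → EqClosure S (t (proj₁ e)) (t (proj₁ (to σ e)))
    rep-out v = closure-isBisimulation bis (first-~ v xs)

    rep-t : ∀ v (e : Out H v) → rep (t (proj₁ e)) ≡ rep (t (proj₁ (to (proj₁ (rep-out v)) e)))
    rep-t v e = first-cong xs (complete _) (proj₂ (rep-out v) e)

    open Quotient rep (proj₁ ∘ rep-out) rep-t

    collapse : NonRedundant H → ∀ {v w} → S v w → v ≡ w
    collapse nonRed {v} {w} s =
      proj₁ (nonRed nec) v w (fromWitness (first-cong xs (complete v) (fwd s ◅ ε)))

  -- An `NEC` is Boolean-valued, so the closure of `S` must be decided. Under a double negation the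
  -- decisions for the finitely many pairs may all be assumed at once.
  nonRedundant⇒discrete : (xs : List V) → (∀ v → v ∈ xs) → NonRedundant H →
    ∀ {S} → IsBisimulation S → ∀ {v w} → S v w → ¬ ¬ (v ≡ w)
  nonRedundant⇒discrete xs complete nonRed bis s v≢w =
    ¬¬-All (λ _ → ¬¬-All (λ _ → ¬¬-excluded-middle) xs) xs λ decs →
      v≢w (Collapse.collapse bis xs complete
        (λ a b → lookup (lookup decs (complete a)) (complete b)) nonRed s)

-- The unfolding tree and its undirected automorphisms

≅-sym : ∀ {G H} → G ≅ H → H ≅ G
≅-sym {G} {H} i = record
  { isoV   = ↔-sym isoV
  ; isoE   = ↔-sym isoE
  ; pres-o = λ e → sym (trans
      (cong (Inverse.from isoV) (trans (sym (cong (Graph.o H) (Inverse.strictlyInverseˡ isoE e))) (pres-o _)))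
      (Inverse.strictlyInverseʳ isoV _))
  ; pres-t = λ e → sym (trans
      (cong (Inverse.from isoV) (trans (sym (cong (Graph.t H) (Inverse.strictlyInverseˡ isoE e))) (pres-t _)))
      (Inverse.strictlyInverseʳ isoV _))
  }
  where open _≅_ i

module Tree {n m : ℕ} (o t : Fin m → Fin n) (R : Fin n) where

  open Finite o t R

  TV-≡ : {p q : TV} → proj₁ p ≡ proj₁ q → p ≡ q
  TV-≡ {_ , vp} {_ , vq} refl = cong (_ ,_) (T-irrelevant vp vq)

  root : TV
  root = [] , tt

  depth : TV → ℕ
  depth p = length (proj₁ p)

  -- Stated on the edge lists alone, so that no validity proofs have to be matched.
  record _◁[_]_ (p : TV) (e : Fin m) (q : TV) : Set where
    constructor child
    field path : proj₁ q ≡ e ∷ proj₁ p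

  open _◁[_]_

  extend-◁ : ∀ p e → o e ≡ term (proj₁ p) → ∃ λ q → p ◁[ e ] q
  extend-◁ p e h = extend (p , e , fromWitness h) , child refl

  ◁-origin : ∀ {p e q} → p ◁[ e ] q → o e ≡ term (proj₁ p)
  ◁-origin {p} {e} {_ , vq} (child refl) = toWitness (proj₁ (Equivalence.to (T-∧ {⌊ o e ≟ term (proj₁ p) ⌋}) vq))

  ◁-term : ∀ {p e q} → p ◁[ e ] q → term (proj₁ q) ≡ t e
  ◁-term (child refl) = refl

  ◁-depth : ∀ {p e q} → p ◁[ e ] q → depth q ≡ suc (depth p)
  ◁-depth (child refl) = refl

  ◁-injective : ∀ {p p′ e e′ q} → p ◁[ e ] q → p′ ◁[ e′ ] q → e ≡ e′ × p ≡ p′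
  ◁-injective (child c) (child c′) with refl , eq ← ∷-injective (trans (sym c) c′) = refl , TV-≡ eq

  ◁-unique : ∀ {p e q q′} → p ◁[ e ] q → p ◁[ e ] q′ → q ≡ q′
  ◁-unique (child c) (child c′) = TV-≡ (trans c (sym c′))

  ◁-asym : ∀ {p e f q} → p ◁[ e ] q → ¬ q ◁[ f ] p
  ◁-asym {p} c c′ = <-irrefl refl
    (≤-trans (s≤s (n≤1+n (depth p))) (≤-reflexive (sym (trans (◁-depth c′) (cong suc (◁-depth c))))))

  tail : ∀ {e p} → T (valid (e ∷ p)) → T (valid p)
  tail {e} {p} v = proj₂ (Equivalence.to (T-∧ {⌊ o e ≟ term p ⌋}) v)

  parent : ∀ q → proj₁ q ≡ [] ⊎ ∃₂ λ p e → p ◁[ e ] q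
  parent ([] , _)    = inj₁ refl
  parent (e ∷ p , v) = inj₂ ((p , tail {e} {p} v) , e , child refl)

  Adjacent : TV → TV → Set
  Adjacent p q = (∃ λ e → p ◁[ e ] q) ⊎ (∃ λ e → q ◁[ e ] p)

  -- At most one edge joins two vertices of the tree, so an undirected automorphism is a vertex
  -- bijection that respects adjacency both ways.
  record Aut : Set where
    field
      to from  : TV → TV
      to-from  : ∀ p → to (from p) ≡ p
      from-to  : ∀ p → from (to p) ≡ p
      to-adj   : ∀ {p q} → Adjacent p q → Adjacent (to p) (to q)
      from-adj : ∀ {p q} → Adjacent p q → Adjacent (from p) (from q)

    injective : ∀ {p q} → to p ≡ to q → p ≡ q
    injective {p} {q} eq = trans (sym (from-to p)) (trans (cong from eq) (from-to q))

    to-child : ∀ {b c g} → b ◁[ g ] c → (∀ h → ¬ to c ◁[ h ] to b) → ∃ λ h → to b ◁[ h ] to c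
    to-child c ¬up with to-adj (inj₁ (_ , c))
    ... | inj₁ down     = down
    ... | inj₂ (h , up) = ⊥-elim (¬up h up)

  open Aut

  inverse : Aut → Aut
  inverse φ = record
    { to = from φ ; from = to φ ; to-from = from-to φ ; from-to = to-from φ
    ; to-adj = from-adj φ ; from-adj = to-adj φ }

  compose : Aut → Aut → Aut
  compose φ ψ = record
    { to       = to φ ∘ to ψ
    ; from     = from ψ ∘ from φ
    ; to-from  = λ p → trans (cong (to φ) (to-from ψ _)) (to-from φ p)
    ; from-to  = λ p → trans (cong (from ψ) (from-to φ _)) (from-to ψ p)
    ; to-adj   = to-adj φ ∘ to-adj ψ
    ; from-adj = from-adj ψ ∘ from-adj φ
    }

  -- From isomorphisms of rerooted trees to automorphisms of the underlying undirected tree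

  reversed-adjacent : ∀ v ed → Adjacent (Graph.o (Unfold^ v) ed) (Graph.t (Unfold^ v) ed)
  reversed-adjacent v ed with onPath v ed
  ... | true  = inj₂ (_ , child refl)
  ... | false = inj₁ (_ , child refl)

  ≅-adjacent : ∀ {v w} (i : Unfold^ v ≅ Unfold^ w) {p q} → Adjacent p q →
    Adjacent (Inverse.to (_≅_.isoV i) p) (Inverse.to (_≅_.isoV i) q)
  ≅-adjacent {v} {w} i = [ (λ (_ , c) → down c) , (λ (_ , c) → swap (down c)) ]′
    where
    open _≅_ i
    f = Inverse.to isoV
    down-edge : ∀ ed → Adjacent (f (proj₁ ed)) (f (extend ed))
    down-edge ed
      with adj ← subst₂ Adjacent (pres-o ed) (pres-t ed) (reversed-adjacent w (Inverse.to isoE ed))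
      with onPath v ed
    ... | true  = swap adj
    ... | false = adj
    down : ∀ {p e q} → p ◁[ e ] q → Adjacent (f p) (f q)
    down {p} {e} {q} c = subst (Adjacent (f p) ∘ f) (TV-≡ (sym (path c)))
      (down-edge (p , e , fromWitness (◁-origin c)))

  -- Prefixes and the base point of a rerooted tree.

  prefix-refl : ∀ q → T (isPrefix q q)
  prefix-refl []      = tt
  prefix-refl (e ∷ q) =
    Equivalence.from (T-∨ {⌊ ≡-dec _≟_ (e ∷ q) (e ∷ q) ⌋}) (inj₁ (fromWitness {a? = ≡-dec _≟_ (e ∷ q) _} refl))

  prefix-[] : ∀ p → T (isPrefix [] p)
  prefix-[] []      = tt
  prefix-[] (e ∷ p) = Equivalence.from (T-∨ {⌊ ≡-dec _≟_ [] (e ∷ p) ⌋}) (inj₂ (prefix-[] p))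

  prefix-length : ∀ q p → T (isPrefix q p) → length q ≤ length p
  prefix-length q [] h with refl ← toWitness {a? = ≡-dec _≟_ q []} h = ≤-refl
  prefix-length q (e ∷ p) h with Equivalence.to (T-∨ {⌊ ≡-dec _≟_ q (e ∷ p) ⌋}) h
  ... | inj₁ q≡p with refl ← toWitness {a? = ≡-dec _≟_ q (e ∷ p)} q≡p = ≤-refl
  ... | inj₂ h′ = m≤n⇒m≤1+n (prefix-length q p h′)

  proper-prefix : ∀ q p → T (valid p) → T (isPrefix q p) → ¬ q ≡ p →
    ∃ λ e → T ⌊ o e ≟ term q ⌋ × T (isPrefix (e ∷ q) p)
  proper-prefix q []      v h q≢p = ⊥-elim (q≢p (toWitness h))
  proper-prefix q (e ∷ p) v h q≢p with Equivalence.to (T-∨ {⌊ ≡-dec _≟_ q (e ∷ p) ⌋}) h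
  ... | inj₁ q≡p = ⊥-elim (q≢p (toWitness q≡p))
  ... | inj₂ h′ = case ≡-dec _≟_ q p of λ where
    (yes refl) → e , proj₁ (Equivalence.to (T-∧ {⌊ o e ≟ term p ⌋}) v) , prefix-refl (e ∷ q)
    (no q≢p′)  → let f , hf , hp = proper-prefix q p (tail {e} {p} v) h′ q≢p′ in
      f , hf , Equivalence.from (T-∨ {⌊ ≡-dec _≟_ (f ∷ q) (e ∷ p) ⌋}) (inj₂ hp)

  -- A reversed edge ends at its upper end, which is shorter than some prefix of `v`; an edge that
  -- ends at `v` in the original tree is itself reversed.
  root-no-incoming : ∀ v ed → ¬ Graph.t (Unfold^ v) ed ≡ v
  root-no-incoming v ed@((p , vp) , e , h) eq with onPath v ed in on
  ... | true with refl ← eq = <-irrefl refl (prefix-length (e ∷ p) p (subst T (sym on) tt))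
  ... | false with refl ← eq = subst T on (prefix-refl (e ∷ p))

  -- If `u` lies above `w`, the next edge towards `w` is reversed and ends at `u`. Otherwise the
  -- edge from the parent of `u` keeps its direction.
  non-root-incoming : ∀ w u → ¬ u ≡ w → ∃ λ ed → Graph.t (Unfold^ w) ed ≡ u
  non-root-incoming w u u≢w with isPrefix (proj₁ u) (proj₁ w) in pre
  ... | true
    with e , h , hp ← proper-prefix (proj₁ u) (proj₁ w) (proj₂ w) (subst T (sym pre) tt) (u≢w ∘ TV-≡)
    = (u , e , h) , lemma
    where
    lemma : Graph.t (Unfold^ w) (u , e , h) ≡ u
    lemma with onPath w (u , e , h)
    ... | true  = refl
    ... | false = ⊥-elim hp
  ... | false with parent u
  ...   | inj₁ refl = ⊥-elim (subst T pre (prefix-[] (proj₁ w)))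
  ...   | inj₂ (p , e , c) = ed , lemma
    where
    ed : TE
    ed = p , e , fromWitness (◁-origin c)
    lemma : Graph.t (Unfold^ w) ed ≡ u
    lemma with onPath w ed in on
    ... | true  = ⊥-elim (subst T (trans (sym on) (trans (cong (λ l → isPrefix l (proj₁ w)) (sym (path c))) pre)) tt)
    ... | false = TV-≡ (sym (path c))

  -- The base point is the only vertex without incoming edges, a property that isomorphisms
  -- preserve.
  ≅-base : ∀ {v w} (i : Unfold^ v ≅ Unfold^ w) → Inverse.to (_≅_.isoV i) v ≡ w
  ≅-base {v} {w} i = case ≡-dec _≟_ (proj₁ (f v)) (proj₁ w) of λ where
      (yes eq)  → TV-≡ eq
      (no fv≢w) → let ed , eq = non-root-incoming w (f v) (fv≢w ∘ cong proj₁) in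
        ⊥-elim (root-no-incoming v (Inverse.from isoE ed)
          (trans (_≅_.pres-t (≅-sym i) ed) (trans (cong (Inverse.from isoV) eq) (Inverse.strictlyInverseʳ isoV v))))
    where
    open _≅_ i
    f = Inverse.to isoV

  ≅⇒Aut : ∀ {v w} → Unfold^ v ≅ Unfold^ w → Σ Aut λ φ → to φ v ≡ w
  ≅⇒Aut {v} {w} i = record
    { to       = Inverse.to isoV
    ; from     = Inverse.from isoV
    ; to-from  = Inverse.strictlyInverseˡ isoV
    ; from-to  = Inverse.strictlyInverseʳ isoV
    ; to-adj   = ≅-adjacent {v} {w} i
    ; from-adj = ≅-adjacent {w} {v} (≅-sym i)
    } , ≅-base {v} {w} i
    where open _≅_ i

  -- Flipping edges

  Below : TV → ℕ → TV → Set
  Below p i a = ∃ λ l → proj₁ a ≡ l ++ proj₁ p × i ≤ length l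

  below-step : ∀ {p i a b} → Below p (suc i) a → Adjacent a b → Below p i b
  below-step (l , eq , h) (inj₁ (e , child c)) =
    e ∷ l , trans c (cong (e ∷_) eq) , ≤-trans (n≤1+n _) (≤-trans h (n≤1+n _))
  below-step (e′ ∷ l , eq , s≤s h) (inj₂ (e , child c)) = l , proj₂ (∷-injective (trans (sym c) eq)) , h

  -- The path from `q` up to the root has `length q` steps, and each step of its image costs at most
  -- one level, so the image never leaves the subtree at `p`.
  below-root : ∀ φ {p} q vq → Below p (length q) (to φ (q , vq)) → Below p 0 (to φ root)
  below-root φ []      _  bel = bel
  below-root φ {p} (e ∷ q) vq bel = below-root φ {p} q (tail {e} {q} vq)
    (below-step {p} bel (to-adj φ (inj₂ (e , child refl))))

  -- A geodesic that starts by descending from the root never turns back.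
  Descends : Aut → TV → Set
  Descends χ z = proj₁ (to χ z) ≡ [] ⊎ ∃₂ λ c g → z ◁[ g ] c × ∃ λ f → to χ c ◁[ f ] to χ z

  -- The place above `to χ z` is either missing or taken by the image of a child of `z`, so the
  -- image of the parent has to lie beneath.
  descends-parent : ∀ χ {p e z} → p ◁[ e ] z → Descends χ z → ∃ λ f → to χ z ◁[ f ] to χ p
  descends-parent χ {p} {e} {z} c d with to-adj χ (inj₂ (e , c)) | d
  ... | inj₁ down     | _       = down
  ... | inj₂ (f , up) | inj₁ eq = case trans (sym eq) (path up) of λ ()
  ... | inj₂ (f , up) | inj₂ (c′ , g , zc , f′ , up′)
    with refl ← injective χ (proj₂ (◁-injective up up′))
    = ⊥-elim (◁-asym c zc)

  descends-ancestor : ∀ χ l {p e a} z → p ◁[ e ] a → proj₁ z ≡ l ++ proj₁ a → Descends χ z →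
    ∃ λ f → to χ a ◁[ f ] to χ p
  descends-ancestor χ [] {a = a} z c eq d with refl ← TV-≡ {z} {a} eq = descends-parent χ c d
  descends-ancestor χ (g ∷ l) {a = a} (_ , vz) c refl d =
    descends-ancestor χ l (l ++ proj₁ a , tail {g} {l ++ proj₁ a} vz) c refl
      (inj₂ (_ , g , child refl , descends-parent χ (child refl) d))

  -- The inverse of `φ` sends `to φ root`, which lies below `p′`, to the root. The path from there
  -- up to `p` thus becomes a descending one, and its last edge is the edge in question.
  flip-below : ∀ φ {p e p′} y → p ◁[ e ] p′ → Below p′ (depth y) (to φ y) →
    ∃ λ f → from φ p′ ◁[ f ] from φ p
  flip-below φ {p′ = p′} (y , vy) c bel with l , eq , _ ← below-root φ {p′} y vy bel =
    descends-ancestor (inverse φ) l (to φ root) c eq (inj₁ (cong proj₁ (from-to φ root)))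

  module _ (noSinks : NoSinks) where

    descend : ℕ → TV → TV
    descend zero    p = p
    descend (suc i) p = proj₁ (extend-◁ (descend i p) (proj₁ out) (proj₂ out))
      where out = noSinks (term (proj₁ (descend i p)))

    descend-below : ∀ i p → ∃ λ l → proj₁ (descend i p) ≡ l ++ proj₁ p × length l ≡ i
    descend-below zero    p = [] , refl , refl
    descend-below (suc i) p with l , eq , len ← descend-below i p
      =
      e ∷ l , cong (e ∷_) eq , cong suc len
      where e = proj₁ (noSinks (term (proj₁ (descend i p))))

    waypoint : TV → ℕ → TV
    waypoint p i = descend (i * depth p) p

    -- Two of the vertices at depths s, 2s, 3s, … below p′ (s being the depth of p′) lie in the
    -- same orbit, and an automorphism taking the upper one to the lower one moves the root below p′.
    flip-edge : Cocompact → ∀ {p e p′} → p ◁[ e ] p′ → Σ Aut λ χ → ∃ λ f → to χ p′ ◁[ f ] to χ p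
    flip-edge (k , l , iso) {p} {e} {p′} c
      with i , j , i<j , eq ← pigeonhole (n<1+n k) (λ i → l (waypoint p′ (toℕ i)))
      with φ , φy≡z ← ≅⇒Aut {waypoint p′ (toℕ i)} {waypoint p′ (toℕ j)}
             (iso (waypoint p′ (toℕ i)) (waypoint p′ (toℕ j)) eq)
         | ly , eqy , leny ← descend-below (toℕ i * depth p′) p′
         | lz , eqz , lenz ← descend-below (toℕ j * depth p′) p′
      = inverse φ , flip-below φ (waypoint p′ (toℕ i)) c
        (subst (Below p′ (depth (waypoint p′ (toℕ i)))) (sym φy≡z)
          -- With s the depth of `p′`, the upper waypoint has depth (i + 1) s, and the lower one
          -- lies j s levels below `p′`, where i < j.
          (lz , eqz , ≤-trans
            (≤-reflexive (trans (cong length eqy) (trans (length-++ ly)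
              (trans (+-comm _ (depth p′)) (cong (depth p′ +_) leny)))))
            (≤-trans (*-monoˡ-≤ (depth p′) i<j) (≤-reflexive (sym lenz)))))

-- Types of the two sides of a tree edge

module Multiplicity {n m : ℕ} (o t : Fin m → Fin n) where

  isEdge : Fin n → Fin n → Fin m → Bool
  isEdge v y e = ⌊ o e ≟ v ⌋ ∧ ⌊ t e ≟ y ⌋

  N : Fin n → Fin n → ℕ
  N v y = count (isEdge v y)

  isEdge⁺ : ∀ {v y e} → o e ≡ v → t e ≡ y → T (isEdge v y e)
  isEdge⁺ {v} {y} {e} p q = Equivalence.from (T-∧ {⌊ o e ≟ v ⌋} {⌊ t e ≟ y ⌋}) (fromWitness p , fromWitness q)

  isEdge⁻ : ∀ {v y} e → T (isEdge v y e) → o e ≡ v × t e ≡ y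
  isEdge⁻ {v} {y} e h with p , q ← Equivalence.to (T-∧ {⌊ o e ≟ v ⌋}) h
    = toWitness p , toWitness q

  N-without : ∀ {v e} → o e ≡ v → ∀ y → N v y ≡ δ (t e) y + count (without (isEdge v y) e)
  N-without {v} {e} refl y = trans (count-without (isEdge v y) e)
    (cong (_+ count (without (isEdge v y) e)) lemma)
    where
    lemma : 𝟙 (isEdge (o e) y e) ≡ δ (t e) y
    lemma with o e ≟ o e
    ... | yes _   = refl
    ... | no oe≢oe = ⊥-elim (oe≢oe refl)

module Types {n m : ℕ} (o t : Fin m → Fin n) (R : Fin n)
  (noSinks : Finite.NoSinks o t R)
  (t≢R : ∀ e → ¬ t e ≡ R)
  (nonRedundant : NonRedundant (Finite.G∖R o t R)) where

  open Finite o t R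
  open Tree o t R
  open Aut
  open _◁[_]_
  open Multiplicity o t
  open Graph G∖R using () renaming (V to V′; E to E′)

  V′-≡ : {x y : V′} → proj₁ x ≡ proj₁ y → x ≡ y
  V′-≡ {_ , p} {_ , q} refl = cong (_ ,_) (T-irrelevant p q)

  E′-≡ : {e f : E′} → proj₁ e ≡ proj₁ f → e ≡ f
  E′-≡ {_ , p , q} {_ , p′ , q′} refl = cong₂ (λ a b → _ , a , b) (T-irrelevant p p′) (T-irrelevant q q′)

  _≟V′_ : DecidableEquality V′
  x ≟V′ y = map′ V′-≡ (cong proj₁) (proj₁ x ≟ proj₁ y)

  _≟E′_ : DecidableEquality E′
  e ≟E′ f = map′ E′-≡ (cong proj₁) (proj₁ e ≟ proj₁ f)

  nonRoot : (v : Fin n) → Dec (v ≡ R) → List V′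
  nonRoot v (yes _)  = []
  nonRoot v (no v≢R) = (v , fromWitnessFalse v≢R) ∷ []

  ∈-nonRoot : ∀ x v≟R → x ∈ nonRoot (proj₁ x) v≟R
  ∈-nonRoot (v , h) (yes v≡R) = ⊥-elim (toWitnessFalse h v≡R)
  ∈-nonRoot (v , h) (no v≢R)  = here (V′-≡ refl)

  vertices : List V′
  vertices = concatMap (λ v → nonRoot v (v ≟ R)) (allFin n)

  ∈-vertices : ∀ x → x ∈ vertices
  ∈-vertices x = ∈-concatMap⁺ _ (lose (∈-allFin (proj₁ x)) (∈-nonRoot x (proj₁ x ≟ R)))

  open Bisimulation G∖R _≟V′_ _≟E′_

  -- Equality in `Fin n` is decidable, which removes the double negation.
  bisimilar⇒≡ : ∀ {S} → IsBisimulation S → ∀ {x y} → S x y → proj₁ x ≡ proj₁ y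
  bisimilar⇒≡ bis {x} {y} s = decidable-stable (proj₁ x ≟ proj₁ y) λ x≢y →
    nonRedundant⇒discrete vertices ∈-vertices nonRedundant bis s (x≢y ∘ cong proj₁)

  outEdge : ∀ (x : V′) e → o e ≡ proj₁ x → Out G∖R x
  outEdge x e eq =
    (e , subst (λ v → False (v ≟ R)) (sym eq) (proj₂ x) , fromWitnessFalse (t≢R e)) , V′-≡ eq

  -- Types are invariant under automorphisms.

  Moved : V′ → V′ → Set
  Moved x y = Σ Aut λ φ → ∃₂ λ a b → ∃₂ λ e f →
    a ◁[ e ] b × to φ a ◁[ f ] to φ b × t e ≡ proj₁ x × t f ≡ proj₁ y

  moved-child : ∀ φ {a b e f} → a ◁[ e ] b → to φ a ◁[ f ] to φ b →
    ∀ {c g} → b ◁[ g ] c → ∃ λ h → to φ b ◁[ h ] to φ c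
  moved-child φ ab ab′ bc = to-child φ bc λ h up →
    case injective φ (proj₂ (◁-injective up ab′)) of λ { refl → ◁-asym ab bc }

  -- Since `to φ a` is the parent of `to φ b`, children of `b` correspond to children of `to φ b`.
  -- This gives the bijection of out-edges, and `φ` itself relates their termini.
  moved-isBisimulation : IsBisimulation Moved
  moved-isBisimulation {x} {y} (φ , a , b , e , f , ab , ab′ , te , tf) =
    ↔-fromRelation ρ forth back
      (λ (c , bc , bc′) (d , bd , bd′) → Out-≡ (E′-≡ (proj₁ (◁-injective bc′
         (subst (λ z → to φ b ◁[ _ ] to φ z) (◁-unique bd bc) bd′)))))
      (λ (c , bc , bc′) (d , bd , bd′) → Out-≡ (E′-≡ (proj₁ (◁-injective bc
         (subst (b ◁[ _ ]_) (injective φ (◁-unique bd′ bc′)) bd)))))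
    , λ g → let c , bc , bc′ = proj₂ (forth g) in φ , b , c , _ , _ , bc , bc′ , refl , refl
    where
    ρ : Out G∖R x → Out G∖R y → Set
    ρ g h = ∃ λ c → b ◁[ proj₁ (proj₁ g) ] c × to φ b ◁[ proj₁ (proj₁ h) ] to φ c
    forth : ∀ g → ∃ (ρ g)
    forth ((g , _) , og)
      with c , bc ← extend-◁ b g (trans (cong proj₁ og) (trans (sym te) (sym (◁-term ab))))
      with h , bc′ ← moved-child φ ab ab′ bc
      = outEdge y h (trans (◁-origin bc′) (trans (◁-term ab′) tf)) , c , bc , bc′
    back : ∀ h → ∃ λ g → ρ g h
    back ((h , _) , oh)
      with d , bd ← extend-◁ (to φ b) h (trans (cong proj₁ oh) (trans (sym tf) (sym (◁-term ab′))))
      with g , bd′ ← moved-child (inverse φ) ab′ (subst₂ _◁[ e ]_ (sym (from-to φ a)) (sym (from-to φ b)) ab) bd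
      with bd″ ← subst (_◁[ g ] from φ d) (from-to φ b) bd′
      = outEdge x g (trans (◁-origin bd″) (trans (◁-term ab) te)) , from φ d , bd″
      , subst (to φ b ◁[ h ]_) (sym (to-from φ d)) bd

  type-invariant : ∀ φ {a b e f} → a ◁[ e ] b → to φ a ◁[ f ] to φ b → t e ≡ t f
  type-invariant φ {a} {b} {e} {f} ab ab′ = bisimilar⇒≡ moved-isBisimulation
    {t e , fromWitnessFalse (t≢R e)} {t f , fromWitnessFalse (t≢R f)}
    (φ , a , b , e , f , ab , ab′ , refl , refl)

  -- W v w: for some tree vertex p of type v, the part of the tree beyond the parent of p
  -- looks like the cone of a vertex of type w.
  W : Fin n → Fin n → Set
  W v w = Σ Aut λ ψ → ∃₂ λ a b → ∃₂ λ e g →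
    a ◁[ e ] b × to ψ b ◁[ g ] to ψ a × t e ≡ v × t g ≡ w

  W⇒≢R : ∀ {v w} → W v w → ¬ v ≡ R
  W⇒≢R (_ , _ , _ , e , _ , _ , _ , refl , _) = t≢R e

  W-sym : ∀ {v w} → W v w → W w v
  W-sym (ψ , a , b , e , g , ab , ba , te , tg) =
    inverse ψ , to ψ b , to ψ a , g , e , ba ,
    subst₂ _◁[ e ]_ (sym (from-to ψ a)) (sym (from-to ψ b)) ab , tg , te

  -- Undoing one flip and applying the other carries one downward edge to the other, so the type
  -- behind an edge does not depend on the flip used to read it.
  backward-type-invariant : ∀ φ ψ {a b g h} → to φ b ◁[ g ] to φ a → to ψ b ◁[ h ] to ψ a → t g ≡ t h
  backward-type-invariant φ ψ {a} {b} {h = h} ba ba′ = type-invariant (compose ψ (inverse φ)) ba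
    (subst₂ _◁[ h ]_ (cong (to ψ) (sym (from-to φ b))) (cong (to ψ) (sym (from-to φ a))) ba′)

  children-≤ : ∀ φ p {f g : Fin m → Bool} → (∀ e → T (f e) → o e ≡ term (proj₁ p)) →
    (∀ {e c} → T (f e) → p ◁[ e ] c → ∃ λ h → T (g h) × to φ p ◁[ h ] to φ c) → count f ≤ count g
  children-≤ φ p {f} {g} of image = count-≤ f g (λ e h → ∃ λ c → p ◁[ e ] c × to φ p ◁[ h ] to φ c)
    (λ e fe → let c , pc = extend-◁ p e (of e fe) ; h , gh , pc′ = image fe pc in h , gh , c , pc , pc′)
    λ (c , pc , pc′) (d , pd , pd′) → proj₁ (◁-injective pc
      (subst (p ◁[ _ ]_) (injective φ (◁-unique pd′ pc′)) pd))

  -- The parent of `q` is the image of `c`, so all other children of `p` go to children of `q` other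
  -- than `q₀`, with types preserved. The images are passed as equations so that the inverse of `φ`
  -- yields the opposite inequality.
  flipped-≤ : ∀ φ {p q p₀ q₀ c d i e f h} → to φ p ≡ q → to φ p₀ ≡ q₀ → to φ c ≡ d →
    p₀ ◁[ i ] p → p ◁[ e ] c → d ◁[ f ] q → q ◁[ h ] q₀ → ∀ y →
    count (without (isEdge (term (proj₁ p)) y) e) ≤ count (without (isEdge (term (proj₁ q)) y) h)
  flipped-≤ φ {p} {c = c} {e = e} {h = h} refl refl refl p₀p pc dq qq₀ y = children-≤ φ p
    (λ e′ fe′ → proj₁ (isEdge⁻ e′ (proj₁ (without-T (isEdge _ _) fe′))))
    λ {e′} {c′} fe′ pc′ →
      let ise , e′≢e = without-T (isEdge _ _) fe′
          h′ , qd = to-child φ pc′ λ g up → e′≢e (proj₁ (◁-injective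
            (subst (p ◁[ e′ ]_) (injective φ (proj₂ (◁-injective up dq))) pc′) pc))
      in h′ , T-without (isEdge _ _) (isEdge⁺ (◁-origin qd) (trans (sym (type-invariant φ pc′ qd)) (proj₂ (isEdge⁻ e′ ise))))
           (λ { refl → ◁-asym p₀p (subst (p ◁[ e′ ]_) (injective φ (◁-unique qd qq₀)) pc′) })
       , qd

  module _ (cocompact : Cocompact) where

    -- Let `χ` flip a tree edge p → c lying over `e`. The children of `to χ p` are the images of the
    -- children of `p` other than `c`, and of the parent `p₀`, whose image has type `w`.
    W-step : ∀ {w} e → W (o e) w → ∃ λ u → W (t e) u × ∀ y → N u y + δ (t e) y ≡ N (o e) y + δ w y
    W-step {w} e (ψ , p₀ , p , i , g , p₀p , pp₀ , ti , tg)
      with c , pc ← extend-◁ p e (trans (sym ti) (sym (◁-term p₀p)))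
      with χ , f , cp ← flip-edge noSinks cocompact pc
      -- The parent of `to χ p` is `to χ c`, so the image of `p₀` must be a child.
      with h , qq₀ ← (case to-adj χ (inj₁ (i , p₀p)) of λ where
             (inj₁ (_ , up)) → ⊥-elim (case injective χ (proj₂ (◁-injective up cp)) of λ { refl → ◁-asym p₀p pc })
             (inj₂ down) → down)
      = t f , (χ , p , c , e , f , pc , cp , refl , refl) , equation
      where
      open ≡-Reasoning
      v = o e
      u = t f
      equation : ∀ y → N u y + δ (t e) y ≡ N v y + δ w y
      equation y = begin
        N u y + δ (t e) y
          ≡⟨ cong (_+ δ (t e) y) (N-without (trans (◁-origin qq₀) (◁-term cp)) y) ⟩
        δ (t h) y + count (without (isEdge u y) h) + δ (t e) y
          ≡⟨ cong₂ (λ x k → δ x y + k + δ (t e) y) (trans (sym (backward-type-invariant ψ χ pp₀ qq₀)) tg) (sym counts) ⟩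
        δ w y + count (without (isEdge v y) e) + δ (t e) y
          ≡⟨ +-comm (δ w y + count (without (isEdge v y) e)) _ ⟩
        δ (t e) y + (δ w y + count (without (isEdge v y) e))
          ≡⟨ cong (δ (t e) y +_) (+-comm (δ w y) _) ⟩
        δ (t e) y + (count (without (isEdge v y) e) + δ w y)
          ≡⟨ sym (+-assoc (δ (t e) y) _ _) ⟩
        δ (t e) y + count (without (isEdge v y) e) + δ w y
          ≡⟨ cong (_+ δ w y) (sym (N-without refl y)) ⟩
        N v y + δ w y ∎
        where
        counts : count (without (isEdge v y) e) ≡ count (without (isEdge u y) h)
        counts = subst₂ (λ a b → count (without (isEdge a y) e) ≡ count (without (isEdge b y) h))
          (trans (◁-term p₀p) ti) (◁-term cp)
          (≤-antisym (flipped-≤ χ refl refl refl p₀p pc cp qq₀ y)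
                     (flipped-≤ (inverse χ) (from-to χ p) (from-to χ c) (from-to χ p₀) cp qq₀ p₀p pc y))

    -- As for `W-step`, except that the root has no parent to contribute a further child.
    W-root : ∀ e → o e ≡ R → ∃ λ u → W (t e) u × ∀ y → N u y + δ (t e) y ≡ N R y
    W-root e oe≡R
      with c , pc ← extend-◁ root e oe≡R
      with χ , f , cp ← flip-edge noSinks cocompact pc
      = t f , (χ , root , c , e , f , pc , cp , refl , refl) , equation
      where
      equation : ∀ y → N (t f) y + δ (t e) y ≡ N R y
      equation y = trans (+-comm (N (t f) y) _) (sym (trans (N-without oe≡R y) (cong (δ (t e) y +_) counts)))
        where
        counts : count (without (isEdge R y) e) ≡ N (t f) y
        counts = ≤-antisym
          (children-≤ χ root (λ e′ fe′ → proj₁ (isEdge⁻ e′ (proj₁ (without-T (isEdge _ _) fe′))))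
            λ {e′} {c′} fe′ pc′ →
              let ise , e′≢e = without-T (isEdge _ _) fe′
                  h , qd = to-child χ pc′ λ g up → e′≢e (proj₁ (◁-injective
                    (subst (root ◁[ e′ ]_) (injective χ (proj₂ (◁-injective up cp))) pc′) pc))
              in h , isEdge⁺ (trans (◁-origin qd) (◁-term cp)) (trans (sym (type-invariant χ pc′ qd)) (proj₂ (isEdge⁻ e′ ise))) , qd)
          (children-≤ (inverse χ) (to χ root) (λ h ih → trans (proj₁ (isEdge⁻ h ih)) (sym (◁-term cp)))
            λ {h} {d} ih qd →
              let e′ , rd = to-child (inverse χ) qd λ g up →
                    case trans (sym (cong proj₁ (from-to χ root))) (path up) of λ ()
                  rd′ = subst (_◁[ e′ ] from χ d) (from-to χ root) rd
              in e′ , T-without (isEdge _ _)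
                   (isEdge⁺ (◁-origin rd′) (trans (sym (type-invariant (inverse χ) qd rd)) (proj₂ (isEdge⁻ h ih))))
                   (λ e′≡e → ◁-asym cp (subst (to χ root ◁[ h ]_)
                         (trans (sym (to-from χ d)) (cong (to χ) (◁-unique
                           (subst (root ◁[_] from χ d) e′≡e rd′) pc))) qd))
                 , rd)

-- Uniqueness of the backward type

module Uniqueness {n m : ℕ} (o t : Fin m → Fin n) (R : Fin n) (W : Fin n → Fin n → Set)
  (step : ∀ {w} e → W (o e) w → ∃ λ u → W (t e) u ×
    ∀ y → Multiplicity.N o t u y + δ (t e) y ≡ Multiplicity.N o t (o e) y + δ w y)
  (W-sym : ∀ {v w} → W v w → W w v)
  (walk : ∀ {v w x y} → W v w → W x y → Path (Finite.G o t R) v x) where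

  open Finite o t R using (G)
  open Multiplicity o t

  step-to : ∀ e → ∃ (W (o e)) → ∃ (W (t e))
  step-to e (w , h) = let u , h′ , _ = step e h in u , h′

  step-N : ∀ e s y → N (proj₁ (step-to e s)) y + δ (t e) y ≡ N (o e) y + δ (proj₁ s) y
  step-N e (w , h) = proj₂ (proj₂ (step e h))

  -- The equation `step-N` recovers `δ w`, hence `w`, from the result of the step.
  step-injective : ∀ e s s′ → proj₁ (step-to e s) ≡ proj₁ (step-to e s′) → proj₁ s ≡ proj₁ s′
  step-injective e s s′ eq = δ-injective λ y → +-cancelˡ-≡ (N (o e) y) _ _
    (trans (sym (step-N e s y)) (trans (cong (λ u → N u y + δ (t e) y) eq) (step-N e s′ y)))

  walk-to : ∀ {v x} → Path G v x → ∃ (W v) → ∃ (W x)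
  walk-to ε       s = s
  walk-to (e ∷ p) s = walk-to p (step-to e s)

  walk-injective : ∀ {v x} (p : Path G v x) s s′ →
    proj₁ (walk-to p s) ≡ proj₁ (walk-to p s′) → proj₁ s ≡ proj₁ s′
  walk-injective ε       s s′ eq = eq
  walk-injective (e ∷ p) s s′ eq = step-injective e s s′ (walk-injective p _ _ eq)

  -- Composing with a walk back gives an injective self-map of a finite set.
  step-surjective : ∀ e → ∃ (W (o e)) → ∀ {y} → W (t e) y → ∃ λ s → proj₁ (step-to e s) ≡ y
  step-surjective e (_ , h) {y} h′ =
    let p = walk h′ h
        s , eq = injective-selfMap⇒surjective (step-to e ∘ walk-to p)
          (λ s s′ → walk-injective p s s′ ∘ step-injective e _ _) (y , h′)
    in walk-to p s , eq

  module _ {e₁ e₂} (e₁≢e₂ : ¬ e₁ ≡ e₂) (o≡ : o e₂ ≡ o e₁) where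

    -- Besides `e₁`, the edge `e₂` is counted in `N (o e₁)`. The step removes only one copy of
    -- `t e₁`, so `t e₂` survives as an out-neighbour, even if the two termini coincide.
    next-edge : ∀ s → ∃ λ e → o e ≡ proj₁ (step-to e₁ s) × t e ≡ t e₂
    next-edge s = let e , h = positive-count (isEdge _ y) bound in e , isEdge⁻ e h
      where
      y = t e₂
      u = proj₁ (step-to e₁ s)
      bound : 1 ≤ N u y
      bound = +-cancelʳ-≤ (δ (t e₁) y) 1 (N u y) (≤-trans
        (≤-trans (≤-reflexive (+-comm 1 _))
          (≤-trans (+-monoʳ-≤ (δ (t e₁) y) (count-positive (without (isEdge (o e₁) y) e₁)
                     (T-without (isEdge (o e₁) y) (isEdge⁺ o≡ refl) (e₁≢e₂ ∘ sym))))
            (≤-trans (≤-reflexive (sym (N-without refl y))) (m≤m+n _ (δ (proj₁ s) y)))))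
        (≤-reflexive (sym (step-N e₁ s y))))

    -- Exchanging t e₁ for w and then t e₂ for z turns N (o e₁) into N of an element of W (t e₂).
    two-steps : ∀ s → ∃ λ e → t e ≡ t e₂ × Σ (o e ≡ proj₁ (step-to e₁ s)) λ _ → ∀ (r : ∃ (W (o e))) y →
      N (proj₁ (step-to e r)) y + δ (t e₂) y + δ (t e₁) y ≡ N (o e₁) y + (δ (proj₁ s) y + δ (proj₁ r) y)
    two-steps s with e , oe , te ← next-edge s = e , te , oe , λ r y → begin
      N (proj₁ (step-to e r)) y + δ (t e₂) y + δ (t e₁) y
        ≡⟨ cong (λ x → N (proj₁ (step-to e r)) y + δ x y + δ (t e₁) y) (sym te) ⟩
      N (proj₁ (step-to e r)) y + δ (t e) y + δ (t e₁) y
        ≡⟨ cong (_+ δ (t e₁) y) (step-N e r y) ⟩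
      N (o e) y + δ (proj₁ r) y + δ (t e₁) y
        ≡⟨ +-assoc (N (o e) y) _ _ ⟩
      N (o e) y + (δ (proj₁ r) y + δ (t e₁) y)
        ≡⟨ cong₂ _+_ (cong (λ u → N u y) oe) (+-comm (δ (proj₁ r) y) _) ⟩
      N (proj₁ (step-to e₁ s)) y + (δ (t e₁) y + δ (proj₁ r) y)
        ≡⟨ sym (+-assoc (N (proj₁ (step-to e₁ s)) y) _ _) ⟩
      N (proj₁ (step-to e₁ s)) y + δ (t e₁) y + δ (proj₁ r) y
        ≡⟨ cong (_+ δ (proj₁ r) y) (step-N e₁ s y) ⟩
      N (o e₁) y + δ (proj₁ s) y + δ (proj₁ r) y
        ≡⟨ +-assoc (N (o e₁) y) _ _ ⟩
      N (o e₁) y + (δ (proj₁ s) y + δ (proj₁ r) y) ∎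
      where open ≡-Reasoning

    -- Every element of W (t e₂) is reached through both s and s′.
    exchange : ∀ s s′ → ¬ proj₁ s ≡ proj₁ s′ → ∀ z → W (proj₁ (step-to e₁ s)) z → z ≡ proj₁ s′
    exchange s s′ s≢s′ z hz
      with e , te , oe , N-e ← two-steps s | e′ , te′ , oe′ , N-e′ ← two-steps s′
      -- The element reached through `s` and `z` is also reached through `s′` and some `r′`.
      with r′ , eq ← step-surjective e′ (_ , subst (λ u → W u (t e₁)) (sym oe′) (W-sym (proj₂ (step-to e₁ s′))))
                       (subst (λ x → W x _) (trans te (sym te′))
                         (proj₂ (step-to e (z , subst (λ u → W u z) (sym oe) hz))))
      -- Cancelling `N (o e₁)` leaves δ s + δ z = δ s′ + δ r′. Evaluation at s′, which differs from
      -- s, forces z = s′.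
      = δ-positive (≤-trans (m≤m+n 1 _) (≤-reflexive (sym (begin
          δ z x′
            ≡⟨ cong (_+ δ z x′) (sym (δ-≢ s≢s′)) ⟩
          δ (proj₁ s) x′ + δ z x′
            ≡⟨ +-cancelˡ-≡ (N (o e₁) x′) _ _ (trans (sym (N-e (z , subst (λ u → W u z) (sym oe) hz) x′))
                 (trans (cong (λ a → N a x′ + δ (t e₂) x′ + δ (t e₁) x′) (sym eq)) (N-e′ r′ x′))) ⟩
          δ x′ x′ + δ (proj₁ r′) x′
            ≡⟨ cong (_+ δ (proj₁ r′) x′) (δ-refl x′) ⟩
          1 + δ (proj₁ r′) x′ ∎))))
      where
      open ≡-Reasoning
      x′ = proj₁ s′

    -- If `s` and `s′` differed, `exchange` would leave `s′` as the only possible element of `W` at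
    -- the end of the walk `p`, and injectivity of the walk would identify them.
    unique-at-branching : ∀ s s′ → proj₁ s ≡ proj₁ s′
    unique-at-branching s s′ = case proj₁ s ≟ proj₁ s′ of λ where
      (yes eq)   → eq
      (no s≢s′) → let p = walk (proj₂ s) (W-sym (proj₂ (step-to e₁ s)))
                      end = λ r → exchange s s′ s≢s′ _ (proj₂ (walk-to p r))
                  in walk-injective p s s′ (trans (end s) (sym (end s′)))

    unique : ∀ {v} (s s′ : ∃ (W v)) → ∃ (W (o e₁)) → proj₁ s ≡ proj₁ s′
    unique s s′ r = let p = walk (proj₂ s) (proj₂ r) in
      walk-injective p s s′ (unique-at-branching (walk-to p s) (walk-to p s′))

-- The labelling

module Labelling {n m : ℕ} (o t : Fin m → Fin n) (R : Fin n) (W : Fin n → Fin n → Set)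
  (W-sym : ∀ {v w} → W v w → W w v)
  (W⇒≢R : ∀ {v w} → W v w → ¬ v ≡ R)
  (inhabited : ∀ v → ¬ v ≡ R → ∃ (W v))
  (unique : ∀ {v w w′} → W v w → W v w′ → w ≡ w′)
  (step : ∀ {w} e → W (o e) w → ∃ λ u → W (t e) u ×
    ∀ y → Multiplicity.N o t u y + δ (t e) y ≡ Multiplicity.N o t (o e) y + δ w y)
  (initial : ∀ e → o e ≡ R → ∃ λ u → W (t e) u ×
    ∀ y → Multiplicity.N o t u y + δ (t e) y ≡ Multiplicity.N o t R y) where

  open Finite o t R
  open Multiplicity o t

  -- The types of all neighbours, parent included, of a tree vertex lying over v.
  A : Fin n → Fin n → ℕ
  A v y with v ≟ R
  ... | yes _  = N v y
  ... | no v≢R = N v y + δ (proj₁ (inhabited v v≢R)) y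

  A-root : A R ≗ N R
  A-root y with R ≟ R
  ... | yes _  = refl
  ... | no R≢R = ⊥-elim (R≢R refl)

  A-W : ∀ {v w} → W v w → ∀ y → A v y ≡ N v y + δ w y
  A-W {v} h y with v ≟ R
  ... | yes v≡R = ⊥-elim (W⇒≢R h v≡R)
  ... | no v≢R  = cong (λ w → N v y + δ w y) (unique (proj₂ (inhabited v v≢R)) h)

  _~_ : Fin n → Fin n → Set
  u ~ v = A u ≗ A v

  _~?_ : ∀ u v → Dec (u ~ v)
  u ~? v = all? λ y → A u y ℕ.≟ A v y

  open Representative {_~_ = _~_} _~?_
    (λ _ → refl) (λ p y → sym (p y)) (λ p q y → trans (p y) (q y))

  -- The intended label is the multiset `A v`. The first vertex with the same multiset stands for
  -- it, which keeps the label set finite.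
  label : Fin n → Fin n
  label v = first v (allFin n)

  label-~ : ∀ v → A (label v) ≗ A v
  label-~ v y = sym (first-~ v (allFin n) y)

  label-cong : ∀ {u v} → A u ≗ A v → label u ≡ label v
  label-cong = first-cong (allFin n) (∈-allFin _)

  parentLabel : ∀ v → False (v ≟ R) → Fin n
  parentLabel v h = label (proj₁ (inhabited v (toWitnessFalse h)))

  M : Fin n → Fin n → ℕ
  M a = push label (A a)

  push-N : ∀ v x → push label (N v) x ≡ outLabels label v x
  push-N v = push-count label (λ e → ⌊ o e ≟ v ⌋) t

  M-label : ∀ {v w} → W v w → ∀ x → M (label v) x ≡ outLabels label v x + δ (label w) x
  M-label {v} {w} h x = begin
    push label (A (label v)) x
      ≡⟨ push-cong label (λ y → trans (label-~ v y) (A-W h y)) x ⟩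
    push label (λ y → N v y + δ w y) x
      ≡⟨ push-+ label (N v) (δ w) x ⟩
    push label (N v) x + push label (δ w) x
      ≡⟨ cong₂ _+_ (push-N v x) (push-δ label w x) ⟩
    outLabels label v x + δ (label w) x ∎
    where open ≡-Reasoning

  -- By symmetry of `W`, `A u` is N u + δ (t e), and the step equation turns this into `A (o e)`. So
  -- the type behind an edge carries the label of the actual parent.
  A-edge : ∀ e → ∃ λ u → W (t e) u × A (o e) ≗ A u
  A-edge e = case o e ≟ R of λ where
    (yes oe≡R) → let u , h , eq = initial e oe≡R in u , h , λ y →
      trans (cong (λ v → A v y) oe≡R) (trans (A-root y) (sym (trans (A-W (W-sym h) y) (eq y))))
    (no oe≢R) → let w , hw = inhabited (o e) oe≢R ; u , h , eq = step e hw in u , h , λ y →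
      trans (A-W hw y) (sym (trans (A-W (W-sym h) y) (eq y)))

  labelling : ActualLabelling
  labelling = record
    { k     = n
    ; l     = label
    ; lp    = parentLabel
    ; M     = M
    ; cond1 = λ v h → subst (0 <_) (sym (M-label (W-parent v h) (parentLabel v h)))
        (≤-trans (≤-reflexive (sym (δ-refl (parentLabel v h)))) (m≤n+m _ (outLabels label v (parentLabel v h))))
    ; cond2 = λ v h x → sym (removal v h x)
    ; cond3 = λ e h → let u , hu , eq = A-edge e in
        trans (label-cong eq) (cong label (unique hu (W-parent (t e) h)))
    ; cond4 = λ x → sym (trans
        (push-cong label (λ y → trans (label-~ R y) (A-root y)) x) (push-N R x))
    }
    where
    W-parent : ∀ v h → W v (proj₁ (inhabited v (toWitnessFalse h)))
    W-parent v h = proj₂ (inhabited v (toWitnessFalse h))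
    removal : ∀ v h x → remove (M (label v)) (parentLabel v h) x ≡ outLabels label v x
    removal v h x with x ≟ parentLabel v h
    ... | yes refl = trans (cong (_∸ 1) (trans (M-label (W-parent v h) x)
                       (cong (outLabels label v x +_) (δ-refl x)))) (m+n∸n≡m (outLabels label v x) 1)
    ... | no x≢    = trans (M-label (W-parent v h) x) (trans
                       (cong (outLabels label v x +_) (δ-≢ (x≢ ∘ sym))) (+-identityʳ _))

-- From the hypotheses to the labelling.

module Main {n m : ℕ} (o t : Fin m → Fin n) (R : Fin n)
  (rooted : Finite.Rooted o t R)
  (noSinks : Finite.NoSinks o t R)
  (t≢R : ∀ e → ¬ t e ≡ R)
  (connected : StronglyConnected (Finite.G∖R o t R))
  (nonRedundant : NonRedundant (Finite.G∖R o t R))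
  (cocompact : Finite.Cocompact o t R) where

  open Finite o t R
  open Types o t R noSinks t≢R nonRedundant
  open Multiplicity o t

  include : ∀ {x y} → Path G∖R x y → Path G (proj₁ x) (proj₁ y)
  include ε                 = ε
  include ((e , _ , _) ∷ p) = e ∷ include p

  walk : ∀ {v w x y} → W v w → W x y → Path G v x
  walk h h′ = include (connected (_ , fromWitnessFalse (W⇒≢R h)) (_ , fromWitnessFalse (W⇒≢R h′)))

  -- `W-root` supplies an element on leaving the root, and `W-step` carries it along the remaining
  -- edges.
  W-along : ∀ {u v} → Path G u v → u ≡ R ⊎ ∃ (W u) → ¬ v ≡ R → ∃ (W v)
  W-along ε       (inj₁ v≡R)     v≢R = ⊥-elim (v≢R v≡R)
  W-along ε       (inj₂ s)       v≢R = s
  W-along (e ∷ p) (inj₁ oe≡R)    v≢R = let u , h , _ = W-root cocompact e oe≡R in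
    W-along p (inj₂ (u , h)) v≢R
  W-along (e ∷ p) (inj₂ (w , h)) v≢R = let u , h′ , _ = W-step cocompact e h in
    W-along p (inj₂ (u , h′)) v≢R

  inhabited : ∀ v → ¬ v ≡ R → ∃ (W v)
  inhabited v = W-along (rooted v) (inj₁ refl)

  open Bisimulation G∖R _≟V′_ _≟E′_ using (IsBisimulation; Out-≡)

  -- Without sinks and without branching every vertex other than the root has exactly one out-edge,
  -- so the out-edge sets are all in bijection.
  all-bisimilar : (∀ e f → o f ≡ o e → ¬ o e ≡ R → e ≡ f) → IsBisimulation (λ _ _ → ⊤)
  all-bisimilar single {x} {y} _ = ↔-fromRelation (λ _ _ → ⊤) (λ _ → out y , tt) (λ _ → out x , tt)
    (λ _ _ → Out-single) (λ _ _ → Out-single) , λ _ → tt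
    where
    out : ∀ x → Out G∖R x
    out x = outEdge x (proj₁ (noSinks (proj₁ x))) (proj₂ (noSinks (proj₁ x)))
    Out-single : ∀ {x} {e f : Out G∖R x} → e ≡ f
    Out-single {x} {(e , _) , oe} {(f , _) , of} = Out-≡ (E′-≡ (single e f
      (cong proj₁ (trans of (sym oe))) (λ oe≡R → toWitnessFalse (proj₂ x) (trans (sym (cong proj₁ oe)) oe≡R))))

  unique : ∀ {v w w′} → W v w → W v w′ → w ≡ w′
  -- The search is for two distinct edges with a common origin other than the root.
  unique {v} h h′ = case any? (λ e → any? λ f → (¬? (e ≟ f)) ×-dec ((o f ≟ o e) ×-dec ¬? (o e ≟ R))) of λ where
    (yes (e , f , e≢f , of≡oe , oe≢R)) →
      Uniqueness.unique o t R W (W-step cocompact) W-sym walk e≢f of≡oe (_ , h) (_ , h′) (inhabited (o e) oe≢R)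
    (no ¬branching) → bisimilar⇒≡
      (all-bisimilar λ e f of≡oe oe≢R → decidable-stable (e ≟ f) λ e≢f →
        ¬branching (e , f , e≢f , of≡oe , oe≢R))
      {_ , fromWitnessFalse (W⇒≢R (W-sym h))} {_ , fromWitnessFalse (W⇒≢R (W-sym h′))} tt

  labelling : ActualLabelling
  labelling = Labelling.labelling o t R W W-sym W⇒≢R inhabited unique (W-step cocompact) (W-root cocompact)

theorem1 : ∀ (n m : ℕ) (o t : Fin m → Fin n) (R : Fin n) →
    Finite.Rooted o t R →
    Finite.NoSinks o t R →
    (∀ (e : Fin m) → ¬ (t e ≡ R)) →
    StronglyConnected (Finite.G∖R o t R) →
    NonRedundant (Finite.G∖R o t R) →
    ¬ Circular (Finite.G∖R o t R) →
    Finite.Cocompact o t R →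
    Finite.ActualLabelling o t R
theorem1 n m o t R rooted noSinks t≢R connected nonRedundant _ cocompact =
  Main.labelling o t R rooted noSinks t≢R connected nonRedundant cocompact
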